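{- Let $S(R_M)$ and $s(k)$ be as defined in the context. Then $$\liminf_{M\to\infty}\frac{S(R_M)}{s(|R_M|)}<1<\limsup_{M\to\infty}\frac{S(R_M)}{s(|R_M|)}.$$
   Context: For a positive integer $n$ and a subset $U\subseteq\mathbb{Z}_n=\mathbb{Z}/n\mathbb{Z}$ of size $k\ge 2$, write its elements as integers $0\le u_1<u_2<\dots<u_k<n$. Put $s_i=u_{i+1}-u_i$ for $1\le i\le k-1$ and $s_k=u_1+n-u_k$. The stochasticity parameter of $U$ is $S(U)=\sum_{i=1}^k s_i^2$. For $2\le k\le n$, $s(k)=s(k,\mathbb{Z}_n)$ denotes the average of $S(U)$ over all subsets $U\subseteq\mathbb{Z}_n$ with $|U|=k$; when $U\subseteq \mathbb{Z}_M$, $s(k)$ is taken with $n=M$. $R_M=\{a^2: a\in\mathbb{Z}_M\}$ is the set of quadratic residues modulo $M$ (including $0$). -}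

module Defs where

open import Data.Nat as ℕ using (ℕ; zero; suc; _+_; _*_; _∸_; _%_; _≟_)
open import Data.Nat.Combinatorics using (_C_)
open import Data.Nat.ListAction using (sum)
open import Data.List using (List; []; _∷_; _++_; [_]; map; length; upTo; filter; any)
open import Data.List.Relation.Unary.Any using (Any)
open import Data.Integer using (+_)
open import Data.Rational as ℚ using (ℚ; 0ℚ; _÷_; _/_)
open import Relation.Nullary using (yes; no)
open import Relation.Binary.PropositionalEquality using (_≡_)
open import Data.List.Relation.Unary.Any using (any?)

-- All k-element subsets of {0,…,n-1}, each given as a strictly increasing list.
combs : ℕ → ℕ → List (List ℕ)
combs zero    n       = [] ∷ []
combs (suc k) zero    = []
combs (suc k) (suc n) = combs (suc k) n ++ map (λ l → l ++ [ n ]) (combs k n)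

-- Cyclic gaps s_1,…,s_k of an increasing list u_1<…<u_k in Z_n:
-- s_i = u_{i+1} - u_i and s_k = u_1 + n - u_k.
gapsFrom : ℕ → ℕ → ℕ → List ℕ → List ℕ
gapsFrom n first prev []       = [ first + n ∸ prev ]
gapsFrom n first prev (x ∷ xs) = (x ∸ prev) ∷ gapsFrom n first x xs

gaps : ℕ → List ℕ → List ℕ
gaps n []       = []
gaps n (x ∷ xs) = gapsFrom n x x xs

Sparam : ℕ → List ℕ → ℕ
Sparam n u = sum (map (λ s → s * s) (gaps n u))

-- a / d as a rational (d = 0 never occurs in the uses below; it is mapped to 0).
frac : ℕ → ℕ → ℚ
frac a zero    = 0ℚ
frac a (suc d) = (+ a) / suc d

savg : ℕ → ℕ → ℚ
savg k n = frac (sum (map (Sparam n) (combs k n))) (n C k)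

-- Division of rationals, with the (never used) convention x / 0 = 0.
_÷'_ : ℚ → ℚ → ℚ
x ÷' y with y ℚ.≟ 0ℚ
... | yes _  = 0ℚ
... | no y≢0 = _÷_ x y {{ℚ.≢-nonZero y≢0}}

R : ℕ → List ℕ
R zero    = []
R (suc m) = filter (λ r → any? (λ a → ((a * a) % suc m) ≟ r) (upTo (suc m))) (upTo (suc m))

ratio : ℕ → ℚ
ratio M = frac (Sparam M (R M)) 1 ÷' savg (length (R M)) M

{-# OPTIONS --safe #-}
module Submission where

open import Defs
open import Data.Bool using (Bool; true; false; if_then_else_; _∧_; not)
open import Data.Bool.ListAction using (all; any)
open import Data.Bool.Properties using (∧-identityʳ; ∧-zeroʳ; ∧-assoc; ∧-comm)
open import Data.Empty using (⊥-elim)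
open import Data.List using (List; []; _∷_; _++_; [_]; map; length; filter; upTo; applyUpTo)
open import Data.List.Membership.Propositional using (_∈_; find; lose)
open import Data.List.Membership.Propositional.Properties using (∈-++⁻; ∈-map⁻; ∈-upTo⁺)
open import Data.List.Properties using (map-++; map-∘)
open import Data.List.Relation.Unary.Any using (here; there; any?)
open import Data.Nat using (ℕ; zero; suc; _+_; _*_; _∸_; _^_; _≤_; _<?_; _≤?_; ≢-nonZero⁻¹; _≥_; z≤n; s≤s; _≡ᵇ_; NonZero; >-nonZero; _%_) renaming (_<_ to _<ⁿ_; _/_ to _/ⁿ_; _≟_ to _≟ⁿ_)
open import Data.Nat.Combinatorics using (_C_; nC1≡n; nCk+nC[k+1]≡[n+1]C[k+1])
open import Data.Nat.DivMod
open import Data.Nat.Divisibility using (_∣_; n∣m*n; ∣⇒≤; ∣m+n∣m⇒∣n)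
open import Data.Nat.ListAction using (sum)
open import Data.Nat.ListAction.Properties using (sum-++)
open import Data.Nat.Properties
open import Data.Nat.Tactic.RingSolver using (solve-∀)
open import Data.Product using (Σ; _×_; _,_; ∃; ∃₂)
import Data.Integer as ℤ
import Data.Integer.Properties as ℤ
open import Data.Rational as ℚ using (ℚ; _<_; 0ℚ; 1ℚ; toℚᵘ)
import Data.Rational.Properties as ℚ
open import Data.Rational.Unnormalised as ℚᵘ using (mkℚᵘ)
import Data.Rational.Unnormalised.Properties as ℚᵘ
open import Data.Sum using (inj₁; inj₂)
open import Function using (_∘_; id)
open import Relation.Nullary using (Dec; yes; no; does)
open import Relation.Nullary.Decidable using (dec-true; dec-false; from-yes; _×-dec_)
open import Relation.Unary using (Decidable)
open import Relation.Binary.PropositionalEquality using (_≡_; _≢_; refl; sym; trans; cong; cong₂; subst; subst₂; module ≡-Reasoning)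

-- Write M = pʲ.  By Hensel's lemma the squares mod M contain every residue that is mod p the
-- square of an a with 2a invertible, and they all reduce to squares mod p; so |R_M| and S(R_M),
-- which decreases when points are added, are controlled by data mod p.  For p = 9 this gives
-- S(R_M) ≤ 3M and |R_M| ≤ 4M/9, hence a limit ratio at most 6/7; for p = 53 it gives
-- S(R_M) ≥ 171M/53 and |R_M| ≥ 26M/53, hence a limit ratio at least 2223/2120.
--
-- Summing waiting times, S(U) + n = 2 #{(x, d) : 0 ≤ d < n, {x, …, x+d−1} misses U}.  The right side is
-- visibly monotone in U, and averaging it over k-subsets gives s(k) = n (2n − k + 1) / (k + 1).

-- Sums over intervals

∑ : ℕ → ℕ → (ℕ → ℕ) → ℕ
∑ a zero    f = 0
∑ a (suc ℓ) f = f a + ∑ (suc a) ℓ f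

∑-cong : ∀ a ℓ {f g} → (∀ x → f x ≡ g x) → ∑ a ℓ f ≡ ∑ a ℓ g
∑-cong a zero    eq = refl
∑-cong a (suc ℓ) eq = cong₂ _+_ (eq a) (∑-cong (suc a) ℓ eq)

∑-mono : ∀ a ℓ {f g} → (∀ x → f x ≤ g x) → ∑ a ℓ f ≤ ∑ a ℓ g
∑-mono a zero    le = z≤n
∑-mono a (suc ℓ) le = +-mono-≤ (le a) (∑-mono (suc a) ℓ le)

∑-const : ∀ a ℓ c → ∑ a ℓ (λ _ → c) ≡ ℓ * c
∑-const a zero    c = refl
∑-const a (suc ℓ) c = cong (c +_) (∑-const (suc a) ℓ c)

∑-+ : ∀ a m ℓ f → ∑ a (m + ℓ) f ≡ ∑ a m f + ∑ (a + m) ℓ f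
∑-+ a zero    ℓ f rewrite +-identityʳ a = refl
∑-+ a (suc m) ℓ f rewrite +-suc a m =
  trans (cong (f a +_) (∑-+ (suc a) m ℓ f)) (sym (+-assoc (f a) _ _))

∑-last : ∀ a ℓ f → ∑ a (suc ℓ) f ≡ ∑ a ℓ f + f (a + ℓ)
∑-last a ℓ f = begin
  ∑ a (suc ℓ) f                  ≡⟨ cong (λ t → ∑ a t f) (+-comm 1 ℓ) ⟩
  ∑ a (ℓ + 1) f                  ≡⟨ ∑-+ a ℓ 1 f ⟩
  ∑ a ℓ f + (f (a + ℓ) + 0)      ≡⟨ cong (∑ a ℓ f +_) (+-identityʳ _) ⟩
  ∑ a ℓ f + f (a + ℓ)            ∎
  where open ≡-Reasoning

∑-shift : ∀ a ℓ n {f} → (∀ x → f (x + n) ≡ f x) → ∑ (a + n) ℓ f ≡ ∑ a ℓ f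
∑-shift a zero    n per = refl
∑-shift a (suc ℓ) n per = cong₂ _+_ (per a) (∑-shift (suc a) ℓ n per)

-- Moving a window of one full period by one step drops `f a` and gains `f (a + n)`, which are
-- equal.
∑-rotate : ∀ a n {f} → (∀ x → f (x + n) ≡ f x) → ∑ a n f ≡ ∑ 0 n f
∑-rotate zero    n     per = refl
∑-rotate (suc a) n {f} per = trans (+-cancelˡ-≡ (f a) _ _ step) (∑-rotate a n per)
  where
  step : f a + ∑ (suc a) n f ≡ f a + ∑ a n f
  step = trans (∑-last a n f) (trans (+-comm (∑ a n f) _) (cong (_+ ∑ a n f) (per a)))

∑-periods : ∀ t n {f} → (∀ x → f (x + n) ≡ f x) → ∑ 0 (t * n) f ≡ t * ∑ 0 n f
∑-periods zero    n     per = refl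
∑-periods (suc t) n {f} per = trans (∑-+ 0 n (t * n) f)
  (cong (∑ 0 n f +_) (trans (∑-shift 0 (t * n) n per) (∑-periods t n per)))

-- Sums over lists

module _ {A : Set} where

  sum-map-cong : ∀ {f g : A → ℕ} L → (∀ {u} → u ∈ L → f u ≡ g u) → sum (map f L) ≡ sum (map g L)
  sum-map-cong []      eq = refl
  sum-map-cong (u ∷ L) eq = cong₂ _+_ (eq (here refl)) (sum-map-cong L (eq ∘ there))

  sum-map-+ : ∀ (f g : A → ℕ) L → sum (map (λ u → f u + g u) L) ≡ sum (map f L) + sum (map g L)
  sum-map-+ f g []      = refl
  sum-map-+ f g (u ∷ L) = trans (cong ((f u + g u) +_) (sum-map-+ f g L)) (interchange (f u) (g u) _ _)
    where
    interchange : ∀ a b c d → a + b + (c + d) ≡ a + c + (b + d)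
    interchange = solve-∀

  sum-map-* : ∀ c (f : A → ℕ) L → sum (map (λ u → c * f u) L) ≡ c * sum (map f L)
  sum-map-* c f []      = sym (*-zeroʳ c)
  sum-map-* c f (u ∷ L) = trans (cong (c * f u +_) (sum-map-* c f L)) (sym (*-distribˡ-+ c (f u) _))

  sum-map-∑ : ∀ a ℓ (f : A → ℕ → ℕ) L → sum (map (λ u → ∑ a ℓ (f u)) L) ≡ ∑ a ℓ (λ x → sum (map (λ u → f u x) L))
  sum-map-∑ a zero    f L = trans (sum-map-* 0 (λ _ → 0) L) refl
  sum-map-∑ a (suc ℓ) f L = trans (sum-map-+ (λ u → f u a) _ L)
    (cong (sum (map (λ u → f u a) L) +_) (sum-map-∑ (suc a) ℓ f L))

ind : Bool → ℕ
ind b = if b then 1 else 0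

-- Waiting times and cyclic gaps

-- One plus the distance from x to the next point of χ at or after x, truncated at m.
wait : (ℕ → Bool) → ℕ → ℕ → ℕ
wait χ zero    x = 0
wait χ (suc m) x = suc (if χ x then 0 else wait χ m (suc x))

wait-periodic : ∀ {χ n} → (∀ x → χ (x + n) ≡ χ x) → ∀ m x → wait χ m (x + n) ≡ wait χ m x
wait-periodic         per zero    x = refl
wait-periodic {χ} {n} per (suc m) x rewrite per x with χ x
... | true  = refl
... | false = cong suc (wait-periodic per m (suc x))

wait-antitone : ∀ {χ ψ} → (∀ x → χ x ≡ true → ψ x ≡ true) → ∀ m x → wait ψ m x ≤ wait χ m x
wait-antitone         imp zero    x = z≤n
wait-antitone {χ} {ψ} imp (suc m) x with χ x in χx | ψ x in ψx
... | true  | true  = s≤s z≤n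
... | false | true  = s≤s z≤n
... | false | false = s≤s (wait-antitone imp m (suc x))
... | true  | false with () ← trans (sym (imp x χx)) ψx

wait-mono : ∀ χ {m m′} → m ≤ m′ → ∀ x → wait χ m x ≤ wait χ m′ x
wait-mono χ z≤n     x = z≤n
wait-mono χ (s≤s le) x with χ x
... | true  = ≤-refl
... | false = s≤s (wait-mono χ le (suc x))

-- A value below `m` is only possible if a point was met before the truncation took effect, so a
-- larger bound finds the same point.
wait-stable : ∀ χ {m m′} x → m ≤ m′ → wait χ m x <ⁿ m → wait χ m′ x ≡ wait χ m x
wait-stable χ {suc m} {suc m′} x (s≤s le) lt with χ x
... | true  = refl
... | false = cong suc (wait-stable χ (suc x) le (≤-pred lt))

-- The list enumerates the points of χ in the interval [a, a + ℓ), in increasing order.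
data Points (χ : ℕ → Bool) : ℕ → List ℕ → ℕ → Set where
  end  : ∀ {a} → Points χ a [] 0
  hit  : ∀ {a us ℓ} → χ a ≡ true → Points χ (suc a) us ℓ → Points χ a (a ∷ us) (suc ℓ)
  skip : ∀ {a us ℓ} → χ a ≡ false → Points χ (suc a) us ℓ → Points χ a us (suc ℓ)

-- The same, for an interval that is empty or ends at a point of χ.
data Points⁺ (χ : ℕ → Bool) : ℕ → List ℕ → ℕ → Set where
  end  : ∀ {a} → Points⁺ χ a [] 0
  hit  : ∀ {a us ℓ} → χ a ≡ true → Points⁺ χ (suc a) us ℓ → Points⁺ χ a (a ∷ us) (suc ℓ)
  skip : ∀ {a u us ℓ} → χ a ≡ false → Points⁺ χ (suc a) (u ∷ us) ℓ → Points⁺ χ a (u ∷ us) (suc ℓ)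

module _ {χ : ℕ → Bool} where

  Points-∈ : ∀ {a us ℓ x} → Points χ a us ℓ → x ∈ us → x <ⁿ a + ℓ
  Points-∈ {a} (hit {ℓ = ℓ} _ p) (here refl) = m<m+n a (s≤s z≤n)
  Points-∈ {a} {x = x} (hit {ℓ = ℓ} _ p) (there i) = subst (x <ⁿ_) (sym (+-suc a ℓ)) (Points-∈ p i)
  Points-∈ {a} {x = x} (skip {ℓ = ℓ} _ p) i = subst (x <ⁿ_) (sym (+-suc a ℓ)) (Points-∈ p i)

  Points-length : ∀ {a us ℓ} → Points χ a us ℓ → length us ≡ ∑ a ℓ (ind ∘ χ)
  Points-length end        = refl
  Points-length (hit e p)  rewrite e = cong suc (Points-length p)
  Points-length (skip e p) rewrite e = Points-length p

  Points-cong : ∀ {ψ a us ℓ} → (∀ x → x <ⁿ a + ℓ → χ x ≡ ψ x) → Points χ a us ℓ → Points ψ a us ℓ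
  Points-cong eq end = end
  Points-cong {a = a} eq (hit {ℓ = ℓ} e p) = hit (trans (sym (eq a (m<m+n a (s≤s z≤n)))) e)
    (Points-cong (λ x lt → eq x (subst (x <ⁿ_) (sym (+-suc a ℓ)) lt)) p)
  Points-cong {a = a} eq (skip {ℓ = ℓ} e p) = skip (trans (sym (eq a (m<m+n a (s≤s z≤n)))) e)
    (Points-cong (λ x lt → eq x (subst (x <ⁿ_) (sym (+-suc a ℓ)) lt)) p)

  Points-∷ʳ : ∀ {a us ℓ} → Points χ a us ℓ → χ (a + ℓ) ≡ true → Points χ a (us ++ [ a + ℓ ]) (suc ℓ)
  Points-∷ʳ {a} end e rewrite +-identityʳ a = hit e end
  Points-∷ʳ {a} (hit {ℓ = ℓ} d p)  e rewrite +-suc a ℓ = hit d (Points-∷ʳ p e)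
  Points-∷ʳ {a} (skip {ℓ = ℓ} d p) e rewrite +-suc a ℓ = skip d (Points-∷ʳ p e)

  Points-skipʳ : ∀ {a us ℓ} → Points χ a us ℓ → χ (a + ℓ) ≡ false → Points χ a us (suc ℓ)
  Points-skipʳ {a} end e rewrite +-identityʳ a = skip e end
  Points-skipʳ {a} (hit {ℓ = ℓ} d p)  e rewrite +-suc a ℓ = hit d (Points-skipʳ p e)
  Points-skipʳ {a} (skip {ℓ = ℓ} d p) e rewrite +-suc a ℓ = skip d (Points-skipʳ p e)

  Points-filter : ∀ {P : ℕ → Set} (P? : Decidable P) a ℓ (f : ℕ → ℕ) → (∀ i → f i ≡ a + i) →
    (∀ x → x <ⁿ a + ℓ → does (P? x) ≡ χ x) → Points χ a (filter P? (applyUpTo f ℓ)) ℓ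
  Points-filter P? a zero    f fi eq = end
  Points-filter P? a (suc ℓ) f fi eq rewrite trans (fi 0) (+-identityʳ a)
    with ih ← Points-filter P? (suc a) ℓ (f ∘ suc) (λ i → trans (fi (suc i)) (+-suc a i))
                (λ x lt → eq x (subst (x <ⁿ_) (sym (+-suc a ℓ)) lt))
    with P? a | eq a (m<m+n a (s≤s z≤n))
  ... | yes _ | e = hit (sym e) ih
  ... | no  _ | e = skip (sym e) ih

  -- The second list is nonempty, so every position skipped in the first interval is still followed
  -- by a point, as `Points⁺` demands.
  Points-++ : ∀ {a us ℓ v vs ℓ′} → Points χ a us ℓ → Points⁺ χ (a + ℓ) (v ∷ vs) ℓ′ → Points⁺ χ a (us ++ v ∷ vs) (ℓ + ℓ′)
  Points-++ {a} end q rewrite +-identityʳ a = q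
  Points-++ {a} (hit {ℓ = ℓ} d p) q rewrite +-suc a ℓ = hit d (Points-++ p q)
  Points-++ {a} (skip {us = []}    {ℓ = ℓ} d p) q rewrite +-suc a ℓ = skip d (Points-++ p q)
  Points-++ {a} (skip {us = _ ∷ _} {ℓ = ℓ} d p) q rewrite +-suc a ℓ = skip d (Points-++ p q)

  Points⁺-≤ : ∀ {a u us ℓ} → Points⁺ χ a (u ∷ us) ℓ → a ≤ u
  Points⁺-≤ (hit _ _)  = ≤-refl
  Points⁺-≤ (skip _ p) = <⇒≤ (Points⁺-≤ p)

  -- The scan starts one past `a` and `wait` adds one to the distance, so the value is the gap
  -- measured from `a` itself.
  wait-Points⁺ : ∀ {a u us ℓ m} → Points⁺ χ (suc a) (u ∷ us) ℓ → ℓ ≤ m → wait χ m (suc a) ≡ u ∸ a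
  wait-Points⁺ {a} (hit e p) (s≤s le) rewrite e = sym (m+n∸n≡m 1 a)
  wait-Points⁺ {a} (skip e p) (s≤s le) rewrite e =
    trans (cong suc (wait-Points⁺ p le)) (sym (+-∸-assoc 1 (<⇒≤ (Points⁺-≤ p))))

squaredGaps : ℕ → List ℕ → ℕ
squaredGaps a []       = 0
squaredGaps a (u ∷ us) = (u ∸ a) * (u ∸ a) + squaredGaps u us

-- Over a gap g the waiting times run through 1, …, g, and g² + g = 2 (1 + ⋯ + g).
squaredGaps-wait : ∀ {χ m a us ℓ} → Points⁺ χ (suc a) us ℓ → ℓ ≤ m → squaredGaps a us + ℓ ≡ 2 * ∑ (suc a) ℓ (wait χ m)
squaredGaps-wait end _ = refl
squaredGaps-wait {χ} {m} {a} pp@(hit {us = us} {ℓ} e p) le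
  rewrite wait-Points⁺ pp le | m+n∸n≡m 1 a =
    trans (arith (squaredGaps (suc a) us) ℓ) (trans (cong (2 +_) (squaredGaps-wait p (≤-trans (n≤1+n ℓ) le)))
      (sym (*-distribˡ-+ 2 1 (∑ (suc (suc a)) ℓ (wait χ m)))))
  where
  arith : ∀ s l → 1 * 1 + s + suc l ≡ 2 + (s + l)
  arith = solve-∀
squaredGaps-wait {χ} {m} {a} pp@(skip {u = u} {us} {ℓ} e p) le
  rewrite wait-Points⁺ pp le | +-∸-assoc 1 (<⇒≤ (Points⁺-≤ p)) =
    trans (arith (u ∸ suc a) (squaredGaps u us) ℓ) (trans (cong (2 * suc (u ∸ suc a) +_) (squaredGaps-wait p (≤-trans (n≤1+n ℓ) le)))
      (sym (*-distribˡ-+ 2 (suc (u ∸ suc a)) (∑ (suc (suc a)) ℓ (wait χ m)))))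
  where
  arith : ∀ h s l → suc h * suc h + s + suc l ≡ 2 * suc h + (h * h + s + l)
  arith = solve-∀

-- The wrap-around gap becomes an ordinary one once the first point, moved up by a full period, is
-- appended to the list.
gapsFrom-squares : ∀ n f a us → sum (map (λ s → s * s) (gapsFrom n f a us)) ≡ squaredGaps a (us ++ [ f + n ])
gapsFrom-squares n f a []       = refl
gapsFrom-squares n f a (u ∷ us) = cong ((u ∸ a) * (u ∸ a) +_) (gapsFrom-squares n f u us)

-- The interval is cut just after its first point `u`. The part up to `u` is moved up by one period,
-- where it continues the part after `u`; together they cover one period ending at the point
-- `u + n`.
Points-unroll : ∀ {χ n a u us ℓ} → (∀ x → χ (x + n) ≡ χ x) → Points χ a (u ∷ us) ℓ →
  ∃₂ λ ℓ₁ ℓ₂ → Points⁺ χ (a + n) [ u + n ] ℓ₁ × Points χ (suc u) us ℓ₂ × ℓ₁ + ℓ₂ ≡ ℓ × suc u + ℓ₂ ≡ a + ℓ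
Points-unroll {a = a} per (hit {ℓ = ℓ} e p) =
  1 , ℓ , hit (trans (per a) e) end , p , refl , sym (+-suc a ℓ)
Points-unroll {a = a} per (skip {ℓ = ℓ} e p) with Points-unroll per p
... | ℓ₁ , ℓ₂ , q , r , eq , eq′ =
  suc ℓ₁ , ℓ₂ , skip (trans (per a) e) q , r , cong suc eq , trans eq′ (sym (+-suc a ℓ))

-- The period is read from `suc u` to `u + n`, so that it starts right after a point and ends at
-- one; periodicity of the waiting times then moves the sum back to start at 0.
Sparam-wait : ∀ {χ n u us} → (∀ x → χ (x + n) ≡ χ x) → Points χ 0 (u ∷ us) n →
  Sparam n (u ∷ us) + n ≡ 2 * ∑ 0 n (wait χ n)
Sparam-wait {χ} {n} {u} {us} per p with Points-unroll per p
... | ℓ₁ , ℓ₂ , q , r , eq , eq′ = begin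
  Sparam n (u ∷ us) + n               ≡⟨ cong (_+ n) (gapsFrom-squares n u u us) ⟩
  squaredGaps u (us ++ [ u + n ]) + n ≡⟨ squaredGaps-wait full ≤-refl ⟩
  2 * ∑ (suc u) n (wait χ n)          ≡⟨ cong (2 *_) (∑-rotate (suc u) n (wait-periodic per n)) ⟩
  2 * ∑ 0 n (wait χ n)                ∎
  where
  open ≡-Reasoning
  full : Points⁺ χ (suc u) (us ++ [ u + n ]) n
  full = subst (Points⁺ χ (suc u) (us ++ [ u + n ])) (trans (+-comm ℓ₂ ℓ₁) eq)
    (Points-++ r (subst (λ t → Points⁺ χ t [ u + n ] ℓ₁) (sym eq′) q))

-- The average of S over all k-element subsets

_∖_ : (ℕ → Bool) → ℕ → ℕ → Bool
(Q ∖ y) i = Q i ∧ not (y ≡ᵇ i)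

-- Reading `all Q u` as "`u` is a subset of `Q`", removing `y` from `Q` adds exactly the condition
-- that `u` misses `y`.
all-∖ : ∀ Q y u → all (Q ∖ y) u ≡ all Q u ∧ not (any (y ≡ᵇ_) u)
all-∖ Q y []      = refl
all-∖ Q y (i ∷ u) rewrite all-∖ Q y u with Q i | y ≡ᵇ i
... | false | _     = refl
... | true  | true  = sym (∧-zeroʳ (all Q u))
... | true  | false = refl

all-∷ʳ : ∀ (Q : ℕ → Bool) u i → all Q (u ++ [ i ]) ≡ all Q u ∧ Q i
all-∷ʳ Q []      i = ∧-identityʳ (Q i)
all-∷ʳ Q (j ∷ u) i = trans (cong (Q j ∧_) (all-∷ʳ Q u i)) (sym (∧-assoc (Q j) _ _))

all-true : ∀ (u : List ℕ) → all (λ _ → true) u ≡ true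
all-true []      = refl
all-true (_ ∷ u) = all-true u

any-∷ʳ : ∀ (P : ℕ → Bool) u i → P i ≡ false → any P (u ++ [ i ]) ≡ any P u
any-∷ʳ P []      i e rewrite e = refl
any-∷ʳ P (j ∷ u) i e with P j
... | true  = refl
... | false = any-∷ʳ P u i e

any-∷ʳ-last : ∀ (P : ℕ → Bool) u i → P i ≡ true → any P (u ++ [ i ]) ≡ true
any-∷ʳ-last P []      i e rewrite e = refl
any-∷ʳ-last P (j ∷ u) i e with P j
... | true  = refl
... | false = any-∷ʳ-last P u i e

≡ᵇ-refl : ∀ n → (n ≡ᵇ n) ≡ true
≡ᵇ-refl zero    = refl
≡ᵇ-refl (suc n) = ≡ᵇ-refl n

≢⇒≡ᵇ : ∀ {m n} → m ≢ n → (m ≡ᵇ n) ≡ false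
≢⇒≡ᵇ {m} {n} m≢n = dec-false (m ≟ⁿ n) m≢n

any-≡ᵇ-fresh : ∀ {n} u → (∀ {x} → x ∈ u → x <ⁿ n) → any (n ≡ᵇ_) u ≡ false
any-≡ᵇ-fresh     []      lt = refl
any-≡ᵇ-fresh {n} (i ∷ u) lt rewrite ≢⇒≡ᵇ (>⇒≢ (lt (here refl))) = any-≡ᵇ-fresh u (lt ∘ there)

∑-∖-≥ : ∀ Q y n → n ≤ y → ∑ 0 n (ind ∘ (Q ∖ y)) ≡ ∑ 0 n (ind ∘ Q)
∑-∖-≥ Q y zero    le = refl
∑-∖-≥ Q y (suc n) le
  rewrite ∑-last 0 n (ind ∘ (Q ∖ y)) | ∑-last 0 n (ind ∘ Q) | ≢⇒≡ᵇ (>⇒≢ le) | ∧-identityʳ (Q n)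
  = cong (_+ ind (Q n)) (∑-∖-≥ Q y n (<⇒≤ le))

∑-∖ : ∀ Q y n → y <ⁿ n → Q y ≡ true → suc (∑ 0 n (ind ∘ (Q ∖ y))) ≡ ∑ 0 n (ind ∘ Q)
∑-∖ Q y (suc n) y<1+n Qy
  rewrite ∑-last 0 n (ind ∘ (Q ∖ y)) | ∑-last 0 n (ind ∘ Q) with y ≟ⁿ n
... | yes refl rewrite ≡ᵇ-refl y | Qy | ∑-∖-≥ Q y y ≤-refl = trans (cong suc (+-identityʳ _)) (+-comm 1 _)
... | no y≢n rewrite ≢⇒≡ᵇ y≢n | ∧-identityʳ (Q n) =
  cong (_+ ind (Q n)) (∑-∖ Q y n (≤∧≢⇒< (≤-pred y<1+n) y≢n) Qy)

ind-all-∷ʳ : ∀ Q u i → ind (all Q (u ++ [ i ])) ≡ ind (Q i) * ind (all Q u)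
ind-all-∷ʳ Q u i rewrite all-∷ʳ Q u i | ∧-comm (all Q u) (Q i) with Q i
... | true  = sym (+-identityʳ _)
... | false = refl

-- What is counted are the `k`-subsets of the points of `Q` below `n`. If the top point lies in `Q`,
-- the recursion of `combs` is Pascal's rule; if not, lists containing it contribute nothing.
combs-all : ∀ Q k n → sum (map (ind ∘ all Q) (combs k n)) ≡ ∑ 0 n (ind ∘ Q) C k
combs-all Q zero    n       = refl
combs-all Q (suc k) zero    = refl
combs-all Q (suc k) (suc n)
  rewrite map-++ (ind ∘ all Q) (combs (suc k) n) (map (_++ [ n ]) (combs k n))
        | sum-++ (map (ind ∘ all Q) (combs (suc k) n)) (map (ind ∘ all Q) (map (_++ [ n ]) (combs k n)))
        | sym (map-∘ {g = ind ∘ all Q} {f = _++ [ n ]} (combs k n))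
        | combs-all Q (suc k) n
        | ∑-last 0 n (ind ∘ Q)
        | sum-map-cong {f = λ u → ind (all Q (u ++ [ n ]))} {g = λ u → ind (Q n) * ind (all Q u)} (combs k n) (λ {u} _ → ind-all-∷ʳ Q u n)
        | sum-map-* (ind (Q n)) (ind ∘ all Q) (combs k n)
        | combs-all Q k n
  with Q n
... | true  rewrite +-identityʳ (∑ 0 n (ind ∘ Q) C k) | +-comm (∑ 0 n (ind ∘ Q)) 1
  = trans (+-comm (∑ 0 n (ind ∘ Q) C suc k) _) (nCk+nC[k+1]≡[n+1]C[k+1] (∑ 0 n (ind ∘ Q)) k)
... | false rewrite +-identityʳ (∑ 0 n (ind ∘ Q)) = +-identityʳ _

combs-length : ∀ k n → sum (map (λ _ → 1) (combs k n)) ≡ n C k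
combs-length k n = trans (sum-map-cong (combs k n) (λ {u} _ → sym (cong ind (all-true u))))
  (trans (combs-all (λ _ → true) k n) (cong (_C k) (trans (∑-const 0 n 1) (*-identityʳ n))))

combs-Points : ∀ k n {u} → u ∈ combs k n → Points (λ x → any (x ≡ᵇ_) u) 0 u n
combs-Points zero    n (here refl) = none 0 n
  where
  none : ∀ a ℓ → Points (λ _ → false) a [] ℓ
  none a zero    = end
  none a (suc ℓ) = skip refl (none (suc a) ℓ)
combs-Points (suc k) (suc n) {u} u∈ with ∈-++⁻ (combs (suc k) n) u∈
... | inj₁ u∈₁ = Points-skipʳ p (any-≡ᵇ-fresh u (Points-∈ p))
  where p = combs-Points (suc k) n u∈₁
... | inj₂ u∈₂ with v , v∈ , refl ← ∈-map⁻ _ u∈₂ =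
  Points-∷ʳ (Points-cong (λ x lt → sym (any-∷ʳ (x ≡ᵇ_) v n (≢⇒≡ᵇ (<⇒≢ lt)))) (combs-Points k n v∈))
    (any-∷ʳ-last (n ≡ᵇ_) v n (≡ᵇ-refl n))

combs-nonempty : ∀ k n {u} → u ∈ combs (suc k) n → ∃₂ λ x v → u ≡ x ∷ v
combs-nonempty k (suc n) u∈ with ∈-++⁻ (combs (suc k) n) u∈
... | inj₁ u∈₁ = combs-nonempty k n u∈₁
... | inj₂ u∈₂ with ∈-map⁻ _ u∈₂
...   | []    , _ , refl = _ , _ , refl
...   | _ ∷ _ , _ , refl = _ , _ , refl

-- Equal residues would make `n` divide `j`, which lies strictly between 0 and `n`.
+-%-injective : ∀ n .{{_ : NonZero n}} x j → 0 <ⁿ j → j <ⁿ n → x % n ≢ (x + j) % n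
+-%-injective n x j 0<j j<n eq = <⇒≱ j<n n≤
  where
  open ≡-Reasoning
  q = x /ⁿ n
  q′ = (x + j) /ⁿ n
  r = x % n
  e : q * n + j ≡ q′ * n
  e = +-cancelˡ-≡ r _ _ (begin
    r + (q * n + j)          ≡⟨ sym (+-assoc r _ j) ⟩
    r + q * n + j            ≡⟨ cong (_+ j) (sym (m≡m%n+[m/n]*n x n)) ⟩
    x + j                    ≡⟨ m≡m%n+[m/n]*n (x + j) n ⟩
    (x + j) % n + q′ * n     ≡⟨ cong (_+ q′ * n) (sym eq) ⟩
    r + q′ * n               ∎)
  n≤ : n ≤ j
  n≤ = ∣⇒≤ {{>-nonZero 0<j}} (∣m+n∣m⇒∣n (subst (n ∣_) (sym e) (n∣m*n q′)) (n∣m*n q))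

-- The indicator of `u` in `ℤ/n`, pulled back to ℕ so that a waiting time may run past `n`.
cyclic : (n : ℕ) .{{_ : NonZero n}} → List ℕ → ℕ → Bool
cyclic n u x = any (x % n ≡ᵇ_) u

-- Each step of wait removes one further residue from Q, so the sum telescopes along Pascal's rule.
combs-wait : ∀ k n .{{_ : NonZero n}} m Q x → m ≤ n → (∀ j → j <ⁿ m → Q ((x + j) % n) ≡ true) → ∑ 0 n (ind ∘ Q) ≡ m →
  sum (map (λ u → ind (all Q u) * wait (cyclic n u) m x) (combs (suc k) n)) ≡ suc m C suc (suc k)
combs-wait k n zero Q x le Qt cnt =
  trans (sum-map-cong (combs (suc k) n) (λ {u} _ → *-zeroʳ (ind (all Q u))))
    (sum-map-* 0 (λ _ → 0) (combs (suc k) n))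
combs-wait k n (suc m) Q x le Qt cnt = begin
  sum (map (λ u → ind (all Q u) * wait (cyclic n u) (suc m) x) L)
    ≡⟨ sum-map-cong L (λ {u} _ → split u) ⟩
  sum (map (λ u → ind (all Q u) + ind (all (Q ∖ y) u) * wait (cyclic n u) m (suc x)) L)
    ≡⟨ sum-map-+ (ind ∘ all Q) _ L ⟩
  sum (map (ind ∘ all Q) L) + sum (map (λ u → ind (all (Q ∖ y) u) * wait (cyclic n u) m (suc x)) L)
    ≡⟨ cong₂ _+_ (trans (combs-all Q (suc k) n) (cong (_C suc k) cnt))
         (combs-wait k n m (Q ∖ y) (suc x) (<⇒≤ le) Qt′ cnt′) ⟩
  suc m C suc k + suc m C suc (suc k)
    ≡⟨ nCk+nC[k+1]≡[n+1]C[k+1] (suc m) (suc k) ⟩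
  suc (suc m) C suc (suc k) ∎
  where
  open ≡-Reasoning
  L = combs (suc k) n
  y = x % n
  Qy : Q y ≡ true
  Qy = trans (cong (λ t → Q (t % n)) (sym (+-identityʳ x))) (Qt 0 (s≤s z≤n))
  cnt′ : ∑ 0 n (ind ∘ (Q ∖ y)) ≡ m
  cnt′ = suc-injective (trans (∑-∖ Q y n (m%n<n x n) Qy) cnt)
  Qt′ : ∀ j → j <ⁿ m → (Q ∖ y) ((suc x + j) % n) ≡ true
  Qt′ j lt rewrite sym (+-suc x j) | Qt (suc j) (s≤s lt)
    | ≢⇒≡ᵇ (+-%-injective n x (suc j) (s≤s z≤n) (≤-trans (s≤s lt) le)) = refl
  -- If `u` contains `y`, the wait is 1 and `u` is not counted for `Q ∖ y`; if it misses `y`, the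
  -- wait is 1 plus the wait from `suc x`.
  split : ∀ u → ind (all Q u) * wait (cyclic n u) (suc m) x ≡
    ind (all Q u) + ind (all (Q ∖ y) u) * wait (cyclic n u) m (suc x)
  split u rewrite all-∖ Q y u with all Q u | any (y ≡ᵇ_) u
  ... | true  | true  = refl
  ... | true  | false = refl
  ... | false | true  = refl
  ... | false | false = refl

-- The absorption identity, by induction along Pascal's rule. It turns the binomial coefficient from
-- `combs-wait` into a multiple of the number of subsets.
C-absorb : ∀ n k → suc k * (suc n C suc k) ≡ suc n * (n C k)
C-absorb n       zero    = trans (*-identityˡ _) (trans (nC1≡n (suc n)) (sym (*-identityʳ (suc n))))
C-absorb zero    (suc k) = trans (*-zeroʳ (suc (suc k))) refl
C-absorb (suc n) (suc k) = begin
  suc (suc k) * (suc (suc n) C suc (suc k))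
    ≡⟨ cong (suc (suc k) *_) (sym (nCk+nC[k+1]≡[n+1]C[k+1] (suc n) (suc k))) ⟩
  suc (suc k) * (b + suc n C suc (suc k))
    ≡⟨ *-distribˡ-+ (suc (suc k)) b _ ⟩
  b + suc k * b + suc (suc k) * (suc n C suc (suc k))
    ≡⟨ cong₂ (λ s t → b + s + t) (C-absorb n k) (C-absorb n (suc k)) ⟩
  b + suc n * (n C k) + suc n * (n C suc k)
    ≡⟨ +-assoc b _ _ ⟩
  b + (suc n * (n C k) + suc n * (n C suc k))
    ≡⟨ cong (b +_) (sym (*-distribˡ-+ (suc n) (n C k) (n C suc k))) ⟩
  b + suc n * (n C k + n C suc k)
    ≡⟨ cong (λ t → b + suc n * t) (nCk+nC[k+1]≡[n+1]C[k+1] n k) ⟩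
  suc (suc n) * b ∎
  where
  open ≡-Reasoning
  b = suc n C suc k

cyclic-periodic : ∀ n .{{_ : NonZero n}} u x → cyclic n u (x + n) ≡ cyclic n u x
cyclic-periodic n u x = cong (λ t → any (t ≡ᵇ_) u) ([m+n]%n≡m%n x n)

-- s(k) = n (2n − k + 1) / (k + 1), cleared of denominators and subtraction.
Sparam-total : ∀ K n .{{_ : NonZero n}} → 0 <ⁿ K →
  suc K * (sum (map (Sparam n) (combs K n)) + n * (n C K)) ≡ 2 * n * (suc n * (n C K))
Sparam-total K@(suc k) n _ = begin
  suc K * (sum (map (Sparam n) L) + n * (n C K))
    ≡⟨ cong (λ t → suc K * (sum (map (Sparam n) L) + t))
         (sym (trans (sum-map-* n (λ _ → 1) L) (cong (n *_) (combs-length K n)))) ⟩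
  suc K * (sum (map (Sparam n) L) + sum (map (λ _ → n * 1) L))
    ≡⟨ cong (suc K *_) (sym (sum-map-+ (Sparam n) (λ _ → n * 1) L)) ⟩
  suc K * sum (map (λ u → Sparam n u + n * 1) L)
    ≡⟨ cong (suc K *_) (sum-map-cong L single) ⟩
  suc K * sum (map (λ u → 2 * ∑ 0 n (λ x → ind (all Q u) * wait (cyclic n u) n x)) L)
    ≡⟨ cong (suc K *_) (sum-map-* 2 _ L) ⟩
  suc K * (2 * sum (map (λ u → ∑ 0 n (λ x → ind (all Q u) * wait (cyclic n u) n x)) L))
    ≡⟨ cong (λ t → suc K * (2 * t)) (sum-map-∑ 0 n _ L) ⟩
  suc K * (2 * ∑ 0 n (λ x → sum (map (λ u → ind (all Q u) * wait (cyclic n u) n x) L)))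
    -- No residue is excluded yet, so each starting point `x` contributes the same binomial
    -- coefficient.
    ≡⟨ cong (λ t → suc K * (2 * t)) (∑-cong 0 n (λ x → combs-wait k n n Q x ≤-refl (λ _ _ → refl)
         (trans (∑-const 0 n 1) (*-identityʳ n)))) ⟩
  suc K * (2 * ∑ 0 n (λ _ → suc n C suc K))
    ≡⟨ cong (λ t → suc K * (2 * t)) (∑-const 0 n (suc n C suc K)) ⟩
  suc K * (2 * (n * (suc n C suc K)))
    ≡⟨ rearrange (suc K) n (suc n C suc K) ⟩
  2 * n * (suc K * (suc n C suc K))
    ≡⟨ cong (2 * n *_) (C-absorb n K) ⟩
  2 * n * (suc n * (n C K)) ∎
  where
  open ≡-Reasoning
  L = combs K n
  Q : ℕ → Bool
  Q _ = true
  rearrange : ∀ a n c → a * (2 * (n * c)) ≡ 2 * n * (a * c)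
  rearrange = solve-∀
  single : ∀ {u} → u ∈ L → Sparam n u + n * 1 ≡ 2 * ∑ 0 n (λ x → ind (all Q u) * wait (cyclic n u) n x)
  single {u} u∈ with x , v , refl ← combs-nonempty k n u∈ = begin
    Sparam n u + n * 1                 ≡⟨ cong (Sparam n u +_) (*-identityʳ n) ⟩
    Sparam n u + n                     ≡⟨ Sparam-wait (cyclic-periodic n u)
        (Points-cong (λ y lt → cong (λ t → any (t ≡ᵇ_) u) (sym (m<n⇒m%n≡m lt))) (combs-Points K n u∈)) ⟩
    2 * ∑ 0 n (wait (cyclic n u) n)    ≡⟨ cong (2 *_) (∑-cong 0 n (λ y →
        sym (trans (cong (λ b → ind b * wait (cyclic n u) n y) (all-true u)) (+-identityʳ _)))) ⟩
    2 * ∑ 0 n (λ x → ind (all Q u) * wait (cyclic n u) n x) ∎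

-- Squares modulo powers of p

does⇒ : ∀ {A : Set} (A? : Dec A) → does A? ≡ true → A
does⇒ (yes a) _ = a

square? : ∀ n .{{_ : NonZero n}} x → Dec _
square? n x = any? (λ a → ((a * a) % n) ≟ⁿ (x % n)) (upTo n)

square : (n : ℕ) .{{_ : NonZero n}} → ℕ → Bool
square n x = does (square? n x)

-- A root `a` with `2 * a` invertible is a simple root of the polynomial a² - x, which is what
-- Hensel lifting requires; this makes sense for composite `n`, such as 9, as well.
unitSquare? : ∀ n .{{_ : NonZero n}} x → Dec _
unitSquare? n x = any? (λ a → (((a * a) % n) ≟ⁿ (x % n)) ×-dec any? (λ b → ((2 * a * b) % n) ≟ⁿ 1) (upTo n)) (upTo n)

unitSquare : (n : ℕ) .{{_ : NonZero n}} → ℕ → Bool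
unitSquare n x = does (unitSquare? n x)

square-periodic : ∀ n .{{_ : NonZero n}} x → square n (x + n) ≡ square n x
square-periodic n x = cong (λ t → does (any? (λ a → ((a * a) % n) ≟ⁿ t) (upTo n))) ([m+n]%n≡m%n x n)

unitSquare-periodic : ∀ n .{{_ : NonZero n}} x → unitSquare n (x + n) ≡ unitSquare n x
unitSquare-periodic n x = cong (λ t → does (any? (λ a → (((a * a) % n) ≟ⁿ t) ×-dec any? (λ b → ((2 * a * b) % n) ≟ⁿ 1) (upTo n)) (upTo n)))
  ([m+n]%n≡m%n x n)

square-intro : ∀ n .{{_ : NonZero n}} a x → (a * a) % n ≡ x % n → square n x ≡ true
square-intro n a x e = dec-true (square? n x)
  (lose (∈-upTo⁺ (m%n<n a n)) (trans (sym (%-distribˡ-* a a n)) e))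

square-elim : ∀ n .{{_ : NonZero n}} x → square n x ≡ true → ∃ λ a → (a * a) % n ≡ x % n
square-elim n x e with a , _ , ea ← find (does⇒ (square? n x) e) = a , ea

-- A root modulo `t * p` remains one modulo `p`. This bounds the squares modulo M from above by a
-- `p`-periodic set.
square-quotient : ∀ p t .{{_ : NonZero p}} .{{_ : NonZero (t * p)}} x → square (t * p) x ≡ true → square p x ≡ true
square-quotient p t x e with a , ea ← square-elim (t * p) x e =
  square-intro p a x (trans (reduce (a * a)) (trans (cong (_% p) ea) (sym (reduce x))))
  where
  reduce : ∀ y → y % p ≡ (y % (t * p)) % p
  reduce y = trans (cong (_% p) (trans (m≡m%n+[m/n]*n y (t * p)) (cong (y % (t * p) +_) (sym (*-assoc (y /ⁿ (t * p)) t p)))))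
    ([m+kn]%n≡m%n (y % (t * p)) (y /ⁿ (t * p) * t) p)

-- A square root of x modulo q at which the derivative 2a is inverted by b modulo p.
record Root (p b x q : ℕ) : Set where
  constructor root
  field
    a c w  : ℕ
    square≡ : a * a ≡ x + w * q
    inverse : 2 * a * b ≡ 1 + c * p

-- Newton's step a ↦ a + (p − 1) w b q; keeping the error w q on the right avoids subtraction.
hensel-step : ∀ p′ b x q′ → let p = suc p′ ; q = q′ * p in Root p b x q → Root p b x (q * p)
hensel-step p′ b x q′ (root a c w sq inv) =
  root (a + s * q) (c + 2 * s * q′ * b) (w + c * p′ * w + s * s * q′) fst snd
  where
  open ≡-Reasoning
  p = suc p′
  q = q′ * p
  s = p′ * w * b
  e₁ : ∀ p′ q′ a b w → (a + p′ * w * b * (q′ * suc p′)) * (a + p′ * w * b * (q′ * suc p′)) ≡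
    a * a + (2 * a * b) * (p′ * w * (q′ * suc p′)) + (p′ * w * b) * (p′ * w * b) * (q′ * suc p′) * (q′ * suc p′)
  e₁ = solve-∀
  e₂ : ∀ p′ q′ x c w s → x + w * (q′ * suc p′) + (1 + c * suc p′) * (p′ * w * (q′ * suc p′)) + s * s * (q′ * suc p′) * (q′ * suc p′) ≡
    x + (w + c * p′ * w + s * s * q′) * (q′ * suc p′ * suc p′)
  e₂ = solve-∀
  e₃ : ∀ p q′ a b s → 2 * (a + s * (q′ * p)) * b ≡ 2 * a * b + 2 * s * q′ * b * p
  e₃ = solve-∀
  e₄ : ∀ c d p → 1 + c * p + d * p ≡ 1 + (c + d) * p
  e₄ = solve-∀
  fst = begin
    (a + s * q) * (a + s * q)                                         ≡⟨ e₁ p′ q′ a b w ⟩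
    a * a + (2 * a * b) * (p′ * w * q) + s * s * q * q                ≡⟨ cong₂ (λ y z → y + z * (p′ * w * q) + s * s * q * q) sq inv ⟩
    x + w * q + (1 + c * p) * (p′ * w * q) + s * s * q * q            ≡⟨ e₂ p′ q′ x c w s ⟩
    x + (w + c * p′ * w + s * s * q′) * (q * p)                       ∎
  snd = trans (e₃ p q′ a b s) (trans (cong (_+ 2 * s * q′ * b * p) inv) (e₄ c (2 * s * q′ * b) p))

hensel : ∀ p′ b x j → let p = suc p′ in Root p b x p → Root p b x (p ^ j * p)
hensel p′ b x zero    r = subst (Root (suc p′) b x) (sym (*-identityˡ (suc p′))) r
hensel p′ b x (suc j) r = subst (λ t → Root (suc p′) b x (t * suc p′)) (*-comm (suc p′ ^ j) (suc p′))
  (hensel-step p′ b x (suc p′ ^ j) (hensel p′ b x j r))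

-- `Root` asks for a square exceeding `x` by a natural multiple of the modulus, so the root is first
-- enlarged by `p * t` with `t = x / p`. As `suc a` is positive, the cross term of the square
-- supplies the `t * p` that completes `x % p` to `x`.
hensel-base : ∀ p .{{_ : NonZero p}} a b x → (suc a * suc a) % p ≡ x % p → (2 * suc a * b) % p ≡ 1 → Root p b x p
hensel-base p a b x sq eb = root (suc a + p * t) (c + 2 * t * b) (suc a * suc a /ⁿ p + t + 2 * a * t + p * t * t) base
  (trans (shift (suc a) b p t) (trans (cong (_+ 2 * t * b * p) (trans (m≡m%n+[m/n]*n (2 * suc a * b) p) (cong (_+ c * p) eb))) (regroup c (2 * t * b) p)))
  where
  open ≡-Reasoning
  t = x /ⁿ p
  c = 2 * suc a * b /ⁿ p
  shift : ∀ a b p t → 2 * (a + p * t) * b ≡ 2 * a * b + 2 * t * b * p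
  shift = solve-∀
  regroup : ∀ c d p → 1 + c * p + d * p ≡ 1 + (c + d) * p
  regroup = solve-∀
  e₁ : ∀ a p t → (suc a + p * t) * (suc a + p * t) ≡ suc a * suc a + (t + t + 2 * a * t + p * t * t) * p
  e₁ = solve-∀
  e₂ : ∀ r w t u v p → r + w * p + (t + t + u + v) * p ≡ r + t * p + (w + t + u + v) * p
  e₂ = solve-∀
  base : (suc a + p * t) * (suc a + p * t) ≡ x + (suc a * suc a /ⁿ p + t + 2 * a * t + p * t * t) * p
  base = begin
    (suc a + p * t) * (suc a + p * t)                                   ≡⟨ e₁ a p t ⟩
    suc a * suc a + (t + t + 2 * a * t + p * t * t) * p                 ≡⟨ cong (_+ (t + t + 2 * a * t + p * t * t) * p)
        (trans (m≡m%n+[m/n]*n (suc a * suc a) p) (cong (_+ suc a * suc a /ⁿ p * p) sq)) ⟩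
    x % p + suc a * suc a /ⁿ p * p + (t + t + 2 * a * t + p * t * t) * p  ≡⟨ e₂ (x % p) (suc a * suc a /ⁿ p) t (2 * a * t) (p * t * t) p ⟩
    x % p + t * p + (suc a * suc a /ⁿ p + t + 2 * a * t + p * t * t) * p  ≡⟨ cong (_+ (suc a * suc a /ⁿ p + t + 2 * a * t + p * t * t) * p) (sym (m≡m%n+[m/n]*n x p)) ⟩
    x + (suc a * suc a /ⁿ p + t + 2 * a * t + p * t * t) * p            ∎

unitSquare⇒square : ∀ p′ j → let p = suc p′ ; M = p ^ j * p in .{{_ : NonZero M}} → ∀ x → unitSquare p x ≡ true → square M x ≡ true
unitSquare⇒square p′ j x e with find (does⇒ (unitSquare? (suc p′) x) e)
-- The root 0 cannot occur: `2 * 0 * b` is never 1 modulo `p`.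
... | zero , _ , _ , inv with _ , _ , () ← find inv
... | suc a , _ , sq , inv
  with b , _ , eb ← find inv
  with root a⁺ _ w sq⁺ _ ← hensel p′ b x j (hensel-base (suc p′) a b x sq eb)
  = square-intro M a⁺ x (trans (cong (_% M) sq⁺) ([m+kn]%n≡m%n x w M))
  where M = suc p′ ^ j * suc p′

-- Bounds for the set of squares from data modulo p

R-Points : ∀ n .{{_ : NonZero n}} → Points (square n) 0 (R n) n
R-Points n@(suc _) = Points-filter _ 0 n id (λ _ → refl)
  -- `R` compares with `x` and `square` with `x % n`; these agree below `n`.
  (λ x lt → cong (λ t → does (any? (λ a → ((a * a) % n) ≟ⁿ t) (upTo n))) (sym (m<n⇒m%n≡m lt)))

R-length : ∀ n .{{_ : NonZero n}} → length (R n) ≡ ∑ 0 n (ind ∘ square n)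
R-length n = Points-length (R-Points n)

R-Sparam : ∀ n .{{_ : NonZero n}} → 0 <ⁿ length (R n) → Sparam n (R n) + n ≡ 2 * ∑ 0 n (wait (square n) n)
R-Sparam n pos with R n | R-Points n
R-Sparam n () | []    | _
R-Sparam n _  | _ ∷ _ | p = Sparam-wait (square-periodic n) p

ind-mono : ∀ {χ ψ : ℕ → Bool} → (∀ x → χ x ≡ true → ψ x ≡ true) → ∀ x → ind (χ x) ≤ ind (ψ x)
ind-mono {χ} {ψ} imp x with χ x in e
... | false = z≤n
... | true rewrite imp x e = ≤-refl

module _ (p′ j : ℕ) where

  private
    p = suc p′
    t = p ^ j
    M = t * p

    instance
      M≢0 : NonZero M
      M≢0 = m*n≢0 t p {{m^n≢0 p j}}

    p≤M : p ≤ M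
    p≤M = m≤n*m p t {{m^n≢0 p j}}

  R-length-lower : t * ∑ 0 p (ind ∘ unitSquare p) ≤ length (R M)
  R-length-lower = begin
    t * ∑ 0 p (ind ∘ unitSquare p) ≡⟨ ∑-periods t p (λ x → cong ind (unitSquare-periodic p x)) ⟨
    ∑ 0 M (ind ∘ unitSquare p)     ≤⟨ ∑-mono 0 M (ind-mono (unitSquare⇒square p′ j)) ⟩
    ∑ 0 M (ind ∘ square M)         ≡⟨ R-length M ⟨
    length (R M)                   ∎
    where open ≤-Reasoning

  R-length-upper : length (R M) ≤ t * ∑ 0 p (ind ∘ square p)
  R-length-upper = begin
    length (R M)                   ≡⟨ R-length M ⟩
    ∑ 0 M (ind ∘ square M)         ≤⟨ ∑-mono 0 M (ind-mono (square-quotient p t)) ⟩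
    ∑ 0 M (ind ∘ square p)         ≡⟨ ∑-periods t p (λ x → cong ind (square-periodic p x)) ⟩
    t * ∑ 0 p (ind ∘ square p)     ∎
    where open ≤-Reasoning

  -- Passing from squares modulo `p` to the smaller set of squares modulo `M` lengthens waits, and
  -- so does raising the truncation from `p` to `M`.
  R-wait-lower : t * ∑ 0 p (wait (square p) p) ≤ ∑ 0 M (wait (square M) M)
  R-wait-lower = begin
    t * ∑ 0 p (wait (square p) p)  ≡⟨ ∑-periods t p (wait-periodic (square-periodic p) p) ⟨
    ∑ 0 M (wait (square p) p)      ≤⟨ ∑-mono 0 M (wait-antitone (square-quotient p t) p) ⟩
    ∑ 0 M (wait (square M) p)      ≤⟨ ∑-mono 0 M (wait-mono (square M) p≤M) ⟩
    ∑ 0 M (wait (square M) M)      ∎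
    where open ≤-Reasoning

  -- The squares modulo `M` contain all lifted unit squares, so waits get shorter. The bound says
  -- that a unit square is always met before the truncation at `p`, hence truncating at `M` instead
  -- changes nothing.
  R-wait-upper : (∀ x → wait (unitSquare p) p x <ⁿ p) → ∑ 0 M (wait (square M) M) ≤ t * ∑ 0 p (wait (unitSquare p) p)
  R-wait-upper bound = begin
    ∑ 0 M (wait (square M) M)          ≤⟨ ∑-mono 0 M (wait-antitone (unitSquare⇒square p′ j) M) ⟩
    ∑ 0 M (wait (unitSquare p) M)      ≡⟨ ∑-cong 0 M (λ x → wait-stable (unitSquare p) x p≤M (bound x)) ⟩
    ∑ 0 M (wait (unitSquare p) p)      ≡⟨ ∑-periods t p (wait-periodic (unitSquare-periodic p) p) ⟩
    t * ∑ 0 p (wait (unitSquare p) p)  ∎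
    where open ≤-Reasoning

-- Comparing rational quotients

÷'-cancel : ∀ x y → 0ℚ < y → (x ÷' y) ℚ.* y ≡ x
÷'-cancel x y 0<y with y ℚ.≟ 0ℚ
... | yes refl = ⊥-elim (ℚ.<-irrefl refl 0<y)
... | no y≢0 = trans (ℚ.*-assoc x _ y) (trans (cong (x ℚ.*_) (ℚ.*-inverseˡ y {{ℚ.≢-nonZero y≢0}})) (ℚ.*-identityʳ x))

frac-pos : ∀ a d → 0 <ⁿ a → 0 <ⁿ d → 0ℚ < frac a d
frac-pos (suc a) (suc d) _ _ = ℚ.positive⁻¹ _ {{ℚ.normalize-pos (suc a) (suc d)}}

frac-≃ : ∀ a d → toℚᵘ (frac a (suc d)) ℚᵘ.≃ mkℚᵘ (ℤ.+ a) d
frac-≃ a d = ℚ.toℚᵘ-fromℚᵘ (mkℚᵘ (ℤ.+ a) d)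

frac*frac-≃ : ∀ a b c d → toℚᵘ (frac a (suc b) ℚ.* frac c (suc d)) ℚᵘ.≃ mkℚᵘ (ℤ.+ a) b ℚᵘ.* mkℚᵘ (ℤ.+ c) d
frac*frac-≃ a b c d = ℚᵘ.≃-trans (ℚ.toℚᵘ-homo-* (frac a (suc b)) (frac c (suc d)))
  (ℚᵘ.*-cong (frac-≃ a b) (frac-≃ c d))

frac<frac*frac : ∀ S α β T C → 0 <ⁿ β → 0 <ⁿ C → β * S * C <ⁿ α * T → frac S 1 < frac α β ℚ.* frac T C
frac<frac*frac S α (suc b) T (suc d) _ _ lt = ℚ.toℚᵘ-cancel-< (ℚᵘ.<-respʳ-≃ (ℚᵘ.≃-sym (frac*frac-≃ α b T d))
  (ℚᵘ.<-respˡ-≃ (ℚᵘ.≃-sym (frac-≃ S 0)) (ℚᵘ.*<* cross)))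
  where
  cross : ℤ.+ S ℤ.* (ℤ.+ suc b ℤ.* ℤ.+ suc d) ℤ.< (ℤ.+ α ℤ.* ℤ.+ T) ℤ.* ℤ.+ 1
  cross rewrite sym (ℤ.pos-* (suc b) (suc d)) | sym (ℤ.pos-* S (suc b * suc d)) | sym (ℤ.pos-* α T) | ℤ.*-identityʳ (ℤ.+ (α * T)) =
    ℤ.+<+ (subst (_<ⁿ α * T) (trans (cong (_* suc d) (*-comm (suc b) S)) (*-assoc S (suc b) (suc d))) lt)

frac*frac<frac : ∀ S α β T C → 0 <ⁿ β → 0 <ⁿ C → α * T <ⁿ β * S * C → frac α β ℚ.* frac T C < frac S 1
frac*frac<frac S α (suc b) T (suc d) _ _ lt = ℚ.toℚᵘ-cancel-< (ℚᵘ.<-respˡ-≃ (ℚᵘ.≃-sym (frac*frac-≃ α b T d))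
  (ℚᵘ.<-respʳ-≃ (ℚᵘ.≃-sym (frac-≃ S 0)) (ℚᵘ.*<* cross)))
  where
  cross : (ℤ.+ α ℤ.* ℤ.+ T) ℤ.* ℤ.+ 1 ℤ.< ℤ.+ S ℤ.* (ℤ.+ suc b ℤ.* ℤ.+ suc d)
  cross rewrite sym (ℤ.pos-* (suc b) (suc d)) | sym (ℤ.pos-* S (suc b * suc d)) | sym (ℤ.pos-* α T) | ℤ.*-identityʳ (ℤ.+ (α * T)) =
    ℤ.+<+ (subst (α * T <ⁿ_) (trans (cong (_* suc d) (*-comm (suc b) S)) (*-assoc S (suc b) (suc d))) lt)

C-pos : ∀ n k → k ≤ n → 0 <ⁿ n C k
C-pos n       zero    _        = s≤s z≤n
C-pos (suc n) (suc k) (s≤s le) = subst (0 <ⁿ_) (nCk+nC[k+1]≡[n+1]C[k+1] n k) (≤-trans (C-pos n k le) (m≤m+n _ _))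

-- If the total vanished, `Sparam-total` would equate `suc K * (n * (n C K))` with twice
-- `suc n * (n * (n C K))`, which is larger because `K ≤ n`.
savg-pos : ∀ K n .{{_ : NonZero n}} → 0 <ⁿ K → K ≤ n → 0ℚ < savg K n
savg-pos K@(suc _) n _ K≤n = frac-pos T (n C K) (n≢0⇒n>0 T≢0) (C-pos n K K≤n)
  where
  open ≤-Reasoning
  T = sum (map (Sparam n) (combs K n))
  e : ∀ n c → 2 * n * (suc n * c) ≡ suc n * (n * c) + suc n * (n * c)
  e = solve-∀
  T≢0 : T ≢ 0
  T≢0 T≡0 = <-irrefl refl (begin-strict
    suc K * (n * (n C K))                                    ≤⟨ *-monoˡ-≤ (n * (n C K)) (s≤s K≤n) ⟩
    suc n * (n * (n C K))                                    <⟨ m<m+n _ {suc n * (n * (n C K))}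
        (*-mono-< {0} {suc n} {0} (s≤s z≤n) (*-mono-< {0} {n} {0} (≤-trans (s≤s z≤n) K≤n) (C-pos n K K≤n))) ⟩
    suc n * (n * (n C K)) + suc n * (n * (n C K))            ≡⟨ e n (n C K) ⟨
    2 * n * (suc n * (n C K))                                ≡⟨ Sparam-total K n (s≤s z≤n) ⟨
    suc K * (T + n * (n C K))                                ≡⟨ cong (λ t → suc K * (t + n * (n C K))) T≡0 ⟩
    suc K * (n * (n C K))                                    ∎)

module _ (S α β K n : ℕ) .{{_ : NonZero n}} (0<β : 0 <ⁿ β) (0<K : 0 <ⁿ K) (K≤n : K ≤ n) where

  private
    c = n C K
    T = sum (map (Sparam n) (combs K n))

    l : ∀ β S K α n c → (β * S * suc K + α * n * suc K) * c ≡ suc K * (β * S * c) + suc K * (α * (n * c))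
    l = solve-∀

    r : α * (2 * n * suc n) * c ≡ suc K * (α * T) + suc K * (α * (n * c))
    r = trans (r₁ α n c) (trans (cong (α *_) (sym (Sparam-total K n 0<K))) (r₂ α K T (n * c)))
      where
      r₁ : ∀ α n c → α * (2 * n * suc n) * c ≡ α * (2 * n * (suc n * c))
      r₁ = solve-∀
      r₂ : ∀ α K T d → α * (suc K * (T + d)) ≡ suc K * (α * T) + suc K * (α * d)
      r₂ = solve-∀

    instance
      c≢0 : NonZero c
      c≢0 = >-nonZero (C-pos n K K≤n)

      y≥0 : ℚ.NonNegative (savg K n)
      y≥0 = ℚ.nonNegative (ℚ.<⇒≤ (savg-pos K n 0<K K≤n))

  -- With s(K) = n (2n - K + 1) / (K + 1) the claim reads β S (K + 1) < α n (2n - K + 1). Adding α n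
  -- (K + 1) to both sides removes the subtraction and gives the hypothesis.
  quotient<frac : β * S * suc K + α * n * suc K <ⁿ α * (2 * n * suc n) → frac S 1 ÷' savg K n < frac α β
  quotient<frac lt = ℚ.*-cancelʳ-<-nonNeg (savg K n)
    (subst (_< frac α β ℚ.* savg K n) (sym (÷'-cancel (frac S 1) (savg K n) (savg-pos K n 0<K K≤n)))
      (frac<frac*frac S α β T c 0<β (C-pos n K K≤n)
        (*-cancelˡ-< (suc K) _ _ (+-cancelʳ-< (suc K * (α * (n * c))) _ _
          (subst₂ _<ⁿ_ (l β S K α n c) r (*-monoˡ-< c lt))))))

  frac<quotient : α * (2 * n * suc n) <ⁿ β * S * suc K + α * n * suc K → frac α β < frac S 1 ÷' savg K n
  frac<quotient lt = ℚ.*-cancelʳ-<-nonNeg (savg K n)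
    (subst (frac α β ℚ.* savg K n <_) (sym (÷'-cancel (frac S 1) (savg K n) (savg-pos K n 0<K K≤n)))
      (frac*frac<frac S α β T c 0<β (C-pos n K K≤n)
        (*-cancelˡ-< (suc K) _ _ (+-cancelʳ-< (suc K * (α * (n * c))) _ _
          (subst₂ _<ⁿ_ r (l β S K α n c) (*-monoˡ-< c lt))))))

-- The moduli 9ʲ and 53ʲ

R-length-≤ : ∀ n .{{_ : NonZero n}} → length (R n) ≤ n
R-length-≤ n = subst₂ _≤_ (sym (R-length n)) (trans (∑-const 0 n 1) (*-identityʳ n)) (∑-mono 0 n (ind≤1 ∘ square n))
  where
  ind≤1 : ∀ b → ind b ≤ 1
  ind≤1 true  = s≤s z≤n
  ind≤1 false = z≤n

periodic-% : ∀ p .{{_ : NonZero p}} {f : ℕ → ℕ} → (∀ x → f (x + p) ≡ f x) → ∀ x → f x ≡ f (x % p)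
periodic-% p {f} per x = trans (cong f (m≡m%n+[m/n]*n x p)) (go (x /ⁿ p))
  where
  go : ∀ k → f (x % p + k * p) ≡ f (x % p)
  go zero    = cong f (+-identityʳ (x % p))
  go (suc k) = trans (cong f (trans (cong (x % p +_) (+-comm p (k * p))) (sym (+-assoc (x % p) (k * p) p)))) (trans (per _) (go k))

n<[2+m]^n : ∀ m n → n <ⁿ (2 + m) ^ n
n<[2+m]^n m zero    = s≤s z≤n
n<[2+m]^n m (suc n) = ≤-trans (s≤s (n<[2+m]^n m n))
  (m<m+n ((2 + m) ^ n) (≤-trans (≤-trans (s≤s z≤n) (n<[2+m]^n m n)) (m≤m+n _ _)))

-- After inserting the bounds, the left side is t² A κ + t A and the right side t² B p + t B. The
-- strict `slope` leaves a spare t², which absorbs t A as soon as `A <ⁿ t`.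
upper-arithmetic : ∀ p σ κ α β t S K → let A = β * σ + α * p ; B = 2 * α * p in
  S ≤ t * σ → K ≤ t * κ → A * κ <ⁿ B * p → A <ⁿ t →
  β * S * suc K + α * (t * p) * suc K <ⁿ α * (2 * (t * p) * suc (t * p))
upper-arithmetic p σ κ α β t S K S≤ K≤ slope A<t = begin-strict
  β * S * suc K + α * (t * p) * suc K              ≤⟨ +-mono-≤ (*-mono-≤ (*-monoʳ-≤ β S≤) (s≤s K≤)) (*-monoʳ-≤ (α * (t * p)) (s≤s K≤)) ⟩
  β * (t * σ) * suc (t * κ) + α * (t * p) * suc (t * κ)  ≡⟨ e₁ p σ κ α β t ⟩
  t * (t * (A * κ) + A)                            <⟨ *-monoʳ-< t {{>-nonZero (≤-trans (s≤s z≤n) A<t)}} (+-monoʳ-< (t * (A * κ)) A<t) ⟩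
  t * (t * (A * κ) + t)                            ≡⟨ e₂ t (A * κ) ⟩
  t * (t * suc (A * κ))                            ≤⟨ *-monoʳ-≤ t (*-monoʳ-≤ t slope) ⟩
  t * (t * (B * p))                                ≤⟨ *-monoʳ-≤ t (m≤m+n (t * (B * p)) B) ⟩
  t * (t * (B * p) + B)                            ≡⟨ e₃ p α t ⟩
  α * (2 * (t * p) * suc (t * p))                  ∎
  where
  open ≤-Reasoning
  A = β * σ + α * p
  B = 2 * α * p
  e₁ : ∀ p σ κ α β t → β * (t * σ) * suc (t * κ) + α * (t * p) * suc (t * κ) ≡ t * (t * ((β * σ + α * p) * κ) + (β * σ + α * p))
  e₁ = solve-∀
  e₂ : ∀ t a → t * (t * a + t) ≡ t * (t * suc a)
  e₂ = solve-∀
  e₃ : ∀ p α t → t * (t * (2 * α * p * p) + 2 * α * p) ≡ α * (2 * (t * p) * suc (t * p))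
  e₃ = solve-∀

-- The same two polynomials in `t`, with the inequality reversed. Here both the quadratic and the
-- linear coefficients compare in the right direction, so every positive `t` works.
lower-arithmetic : ∀ p σ κ α β t S K → let A = β * σ + α * p ; B = 2 * α * p in
  t * σ ≤ S → t * κ ≤ K → B * p ≤ A * κ → B <ⁿ A → 0 <ⁿ t →
  α * (2 * (t * p) * suc (t * p)) <ⁿ β * S * suc K + α * (t * p) * suc K
lower-arithmetic p σ κ α β t S K S≥ K≥ slope B<A 0<t = begin-strict
  α * (2 * (t * p) * suc (t * p))                  ≡⟨ e₁ p α t ⟩
  t * (t * (B * p) + B)                            <⟨ *-monoʳ-< t {{>-nonZero 0<t}} (+-mono-≤-< (*-monoʳ-≤ t slope) B<A) ⟩
  t * (t * (A * κ) + A)                            ≡⟨ e₂ p σ κ α β t ⟩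
  β * (t * σ) * suc (t * κ) + α * (t * p) * suc (t * κ)  ≤⟨ +-mono-≤ (*-mono-≤ (*-monoʳ-≤ β S≥) (s≤s K≥)) (*-monoʳ-≤ (α * (t * p)) (s≤s K≥)) ⟩
  β * S * suc K + α * (t * p) * suc K              ∎
  where
  open ≤-Reasoning
  A = β * σ + α * p
  B = 2 * α * p
  e₁ : ∀ p α t → α * (2 * (t * p) * suc (t * p)) ≡ t * (t * (2 * α * p * p) + 2 * α * p)
  e₁ = solve-∀
  e₂ : ∀ p σ κ α β t → t * (t * ((β * σ + α * p) * κ) + (β * σ + α * p)) ≡ β * (t * σ) * suc (t * κ) + α * (t * p) * suc (t * κ)
  e₂ = solve-∀

-- σ / p and κ / p are the densities of S(R_M) and |R_M| forced by the data mod p.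
module _ (p′ σ κ α β : ℕ) (0<β : 0 <ⁿ β) (0<units : 0 <ⁿ ∑ 0 (suc p′) (ind ∘ unitSquare (suc p′))) (j : ℕ) where

  private
    p = suc p′
    t = p ^ j
    M = t * p
    S = Sparam M (R M)
    K = length (R M)
    A = β * σ + α * p
    B = 2 * α * p

    0<t : 0 <ⁿ t
    0<t = n≢0⇒n>0 (≢-nonZero⁻¹ t {{m^n≢0 p j}})

    instance
      M≢0 : NonZero M
      M≢0 = m*n≢0 t p {{m^n≢0 p j}}

    0<K : 0 <ⁿ K
    0<K = ≤-trans (*-mono-< {0} {t} {0} 0<t 0<units) (R-length-lower p′ j)

    distrib : ∀ {D} → 2 * D ≡ σ + p → 2 * (t * D) ≡ t * σ + M
    distrib {D} e = trans (swap t D) (trans (cong (t *_) e) (*-distribˡ-+ t σ p))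
      where
      swap : ∀ t d → 2 * (t * d) ≡ t * (2 * d)
      swap = solve-∀

  -- Since s(k) decreases in k, an upper bound for the ratio needs upper bounds for both `S` and
  -- `K`: `σ` comes from the unit squares, `κ` from all squares.
  ratio<frac : (∀ x → wait (unitSquare p) p x <ⁿ p) → 2 * ∑ 0 p (wait (unitSquare p) p) ≡ σ + p →
    ∑ 0 p (ind ∘ square p) ≡ κ → A * κ <ⁿ B * p → A <ⁿ t → ratio M < frac α β
  ratio<frac bound D≡ κ≡ slope A<t = quotient<frac S α β K M 0<β 0<K (R-length-≤ M)
    (upper-arithmetic p σ κ α β t S K S≤ (subst (λ k → K ≤ t * k) κ≡ (R-length-upper p′ j)) slope A<t)
    where
    S≤ : S ≤ t * σ
    S≤ = +-cancelʳ-≤ M S (t * σ) (subst₂ _≤_ (sym (R-Sparam M 0<K)) (distrib D≡) (*-monoʳ-≤ 2 (R-wait-upper p′ j bound)))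

  -- The roles are exchanged: `σ` now comes from all squares and `κ` from the unit squares, giving
  -- lower bounds for both `S` and `K`.
  frac<ratio : 2 * ∑ 0 p (wait (square p) p) ≡ σ + p → ∑ 0 p (ind ∘ unitSquare p) ≡ κ →
    B * p ≤ A * κ → B <ⁿ A → frac α β < ratio M
  frac<ratio D≡ κ≡ slope B<A = frac<quotient S α β K M 0<β 0<K (R-length-≤ M)
    (lower-arithmetic p σ κ α β t S K S≥ (subst (λ k → t * k ≤ K) κ≡ (R-length-lower p′ j)) slope B<A 0<t)
    where
    S≥ : t * σ ≤ S
    S≥ = +-cancelʳ-≤ M (t * σ) S (subst₂ _≤_ (distrib D≡) (sym (R-Sparam M 0<K)) (*-monoʳ-≤ 2 (R-wait-lower p′ j)))

n≤[2+m]^n*[2+m] : ∀ m n → n ≤ (2 + m) ^ n * (2 + m)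
n≤[2+m]^n*[2+m] m n = ≤-trans (<⇒≤ (n<[2+m]^n m n)) (m≤m*n ((2 + m) ^ n) (2 + m))

-- By periodicity it is enough to evaluate the nine residues.
wait-unitSquare-9 : ∀ x → wait (unitSquare 9) 9 x <ⁿ 9
wait-unitSquare-9 x = subst (_<ⁿ 9) (sym (periodic-% 9 (wait-periodic (unitSquare-periodic 9) 9) x))
  (from-yes (allUpTo? (λ y → wait (unitSquare 9) 9 y <? 9) 9) (m%n<n x 9))

-- 351 = 10 · 27 + 9 · 9 is the threshold A of ratio<frac for p = 9, σ = 27, α / β = 9 / 10.
ratio-9 : ∀ j → 351 ≤ j → ratio (9 ^ j * 9) < frac 9 10
ratio-9 j le = ratio<frac 8 27 4 9 10 (s≤s z≤n) (s≤s z≤n) j wait-unitSquare-9 refl refl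
  (from-yes (351 * 4 <? 162 * 9)) (≤-<-trans le (n<[2+m]^n 7 j))

ratio-53 : ∀ j → frac 41 40 < ratio (53 ^ j * 53)
ratio-53 j = frac<ratio 52 171 26 41 40 (s≤s z≤n) (s≤s z≤n) j refl refl
  -- 4346 = 2 · 41 · 53 is `B` and 9013 = 40 · 171 + 41 · 53 is `A`; 26 counts the nonzero squares
  -- modulo 53.
  (from-yes (4346 * 53 ≤? 9013 * 26)) (from-yes (4346 <? 9013))

theorem1p1 : (Σ ℚ λ c → c < 1ℚ × ((N : ℕ) → Σ ℕ λ M → M ≥ N × ratio M < c))
    × (Σ ℚ λ c → 1ℚ < c × ((N : ℕ) → Σ ℕ λ M → M ≥ N × c < ratio M))
theorem1p1 =
  -- A bound strictly below 1 that is attained for arbitrarily large M expresses the liminf claim;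
  -- 9/10 lies between 6/7 and 1. The exponent `351 + N` meets the threshold of `ratio-9` and makes
  -- M at least `N`.
  (frac 9 10 , from-yes (frac 9 10 ℚ.<? 1ℚ) , λ N → below (351 + N) (m≤m+n 351 N) (m≤n+m N 351)) ,
  -- 41/40 lies between 1 and 2223/2120.
  (frac 41 40 , from-yes (1ℚ ℚ.<? frac 41 40) , λ N → 53 ^ N * 53 , n≤[2+m]^n*[2+m] 51 N , ratio-53 N)
  where
  below : ∀ {N} j → 351 ≤ j → N ≤ j → Σ ℕ λ M → M ≥ N × ratio M < frac 9 10
  below j le N≤j = 9 ^ j * 9 , ≤-trans N≤j (n≤[2+m]^n*[2+m] 7 j) , ratio-9 j le
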